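{- Let $N=2^e t+1>3$, where $t$ is odd and $2^e>t>0$, and suppose that $3\nmid t$. Then $N$ is prime if and only if $$3^{(N-1)/2}\equiv -1\pmod{N}.$$
   Context: Here $e$ and $t$ are integers; numbers $N=2^e\cdot t+1$ with $t$ odd and $2^e>t>0$ are called Proth numbers. -}

module Defs where

open import Data.Integer using (ℤ; _-_)
open import Data.Integer.Divisibility using (_∣_)

infix 4 _≡_[mod_]

_≡_[mod_] : ℤ → ℤ → ℤ → Set
a ≡ b [mod n ] = n ∣ a - b

{-# OPTIONS --safe #-}
-- (⇐) Let d > 1 divide N and put b = 3ᵗ. Modulo d, b^(2^(e-1)) ≡ -1 ≢ 1, so b has order
-- exactly 2^e and its first 2^e powers are distinct, whence d ≥ 2^e > √N by pigeonhole.
-- So N has no proper divisor.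
--
-- (⇒) A prime N as given is ≡ 5 (mod 12). For a prime p = 6m + 5 put h = (p - 1) / 2 = 3m + 2
-- and reduce the factors of 3·6·…·3h = 3^h h! to absolutely least residues: the first m are
-- the multiples of 3 up to h, the next m + 1 are the negatives of the numbers ≡ 2 (mod 3)
-- up to h, the last m + 1 are the numbers ≡ 1 (mod 3) up to h. Hence
-- 3^h h! ≡ (-1)^(m+1) h!, and h! cancels.
module Submission where

open import Defs
open import Data.Fin using (toℕ; fromℕ<)
open import Data.Fin.Patterns using (0F; 1F; 2F)
open import Data.Fin.Properties using (pigeonhole; toℕ<n; fromℕ<-injective)
open import Data.Nat using (ℕ; _+_; _*_; _∸_; _<_; _>_; _^_)
open import Data.Nat using (zero; suc; _≤_; z<s; s<s; _≤?_; NonZero; NonTrivial; nonTrivial⇒nonZero; nonTrivial⇒≢1; n>1⇒nonTrivial)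
open import Data.Nat.DivMod using (_/_)
open import Data.Nat.DivMod using (_divMod_; result; m*n/n≡m)
open import Data.Nat.Divisibility using (_∤_)
open import Data.Nat.Divisibility using (_∣_; divides; hasNonTrivialDivisor; ∣-trans; ∣⇒≤; m∣m*n; ∣m+n∣m⇒∣n; ∣1⇒≡1)
open import Data.Nat.Primality using (Prime)
open import Data.Nat.Primality using (prime?; prime[2]; euclidsLemma; prime⇒irreducible; ¬composite⇒prime)
open import Data.Nat.Properties
open import Data.Integer using (+_; -_) renaming (_^_ to _^ℤ_)
open import Data.Integer as ℤ using (ℤ; 1ℤ; -1ℤ; _%ℕ_; _/ℕ_)
open import Data.Integer.DivMod using (a≡a%ℕn+[a/ℕn]*n; n%ℕd<d)
import Data.Integer.Divisibility.Signed as Signed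
import Data.Integer.Properties as ℤ
import Data.Integer.Tactic.RingSolver as ℤ-Solver
import Data.Nat.Tactic.RingSolver as ℕ-Solver
open import Data.Product using (∃-syntax; _,_)
open import Data.Sum using (inj₁; inj₂)
open import Function using (_∘_)
open import Function.Bundles using (_⇔_)
open import Function.Bundles using (mk⇔)
open import Relation.Binary.Bundles using (Setoid)
open import Relation.Binary.PropositionalEquality using (_≡_; refl; sym; trans; cong; subst; subst₂; module ≡-Reasoning)
import Relation.Binary.Reasoning.Setoid as SetoidReasoning
open import Relation.Nullary using (¬_; yes; no; contradiction)
open import Relation.Nullary.Decidable using (toWitness)

-- Finite products of integers and powers of -1.

∏ : (ℕ → ℤ) → ℕ → ℤ
∏ f zero    = 1ℤ
∏ f (suc n) = ∏ f n ℤ.* f n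

∏-+ : ∀ f m n → ∏ f (m + n) ≡ ∏ f m ℤ.* ∏ (λ i → f (m + i)) n
∏-+ f m zero    = trans (cong (∏ f) (+-identityʳ m)) (sym (ℤ.*-identityʳ _))
∏-+ f m (suc n) = begin
  ∏ f (m + suc n)                                  ≡⟨ cong (∏ f) (+-suc m n) ⟩
  ∏ f (m + n) ℤ.* f (m + n)                        ≡⟨ cong (ℤ._* f (m + n)) (∏-+ f m n) ⟩
  ∏ f m ℤ.* ∏ (λ i → f (m + i)) n ℤ.* f (m + n)         ≡⟨ ℤ.*-assoc (∏ f m) _ _ ⟩
  ∏ f m ℤ.* (∏ (λ i → f (m + i)) n ℤ.* f (m + n))       ∎
  where open ≡-Reasoning

∏-scale : ∀ c f n → ∏ (λ i → c ℤ.* f i) n ≡ c ^ℤ n ℤ.* ∏ f n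
∏-scale c f zero    = refl
∏-scale c f (suc n) =
  trans (cong (ℤ._* (c ℤ.* f n)) (∏-scale c f n)) (interchange (c ^ℤ n) (∏ f n) c (f n))
  where
  interchange : ∀ x y z w → x ℤ.* y ℤ.* (z ℤ.* w) ≡ z ℤ.* x ℤ.* (y ℤ.* w)
  interchange = ℤ-Solver.solve-∀

∏-suc : ∀ f n → ∏ f (suc n) ≡ f 0 ℤ.* ∏ (f ∘ suc) n
∏-suc f n = trans (∏-+ f 1 n) (cong (ℤ._* ∏ (f ∘ suc) n) (ℤ.*-identityˡ (f 0)))

_! : ℕ → ℤ
_! = ∏ (λ i → + suc i)

-- The blocks on the right are, up to sign, the least residues of 3, 6, ..., 3h for h = 2 + 3m.
-- Passing from m to m + 1 appends one factor to each.
!-by-residues-mod-3 : ∀ m →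
  (2 + m * 3) ! ≡ ∏ (λ i → + (suc i * 3)) m
              ℤ.* (∏ (λ i → + (2 + i * 3)) (suc m) ℤ.* ∏ (λ i → + (1 + i * 3)) (suc m))
!-by-residues-mod-3 zero    = refl
!-by-residues-mod-3 (suc m) =
  trans (cong (λ x → x ℤ.* + (3 + m * 3) ℤ.* + (4 + m * 3) ℤ.* + (5 + m * 3)) (!-by-residues-mod-3 m))
        (rearrange (∏ _ m) (∏ _ (suc m)) (∏ _ (suc m)) _ _ _)
  where
  rearrange : ∀ a b c x y z →
    a ℤ.* (b ℤ.* c) ℤ.* x ℤ.* y ℤ.* z ≡ a ℤ.* x ℤ.* (b ℤ.* z ℤ.* (c ℤ.* y))
  rearrange = ℤ-Solver.solve-∀

-1^[2*n] : ∀ n → -1ℤ ^ℤ (2 * n) ≡ 1ℤ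
-1^[2*n] n = trans (sym (ℤ.^-*-assoc -1ℤ 2 n)) (ℤ.^-zeroˡ n)

-1^[1+2*n] : ∀ n → -1ℤ ^ℤ suc (2 * n) ≡ -1ℤ
-1^[1+2*n] n = cong (-1ℤ ℤ.*_) (-1^[2*n] n)

^-swap : ∀ b m n → (b ^ℤ m) ^ℤ n ≡ (b ^ℤ n) ^ℤ m
^-swap b m n = begin
  (b ^ℤ m) ^ℤ n ≡⟨ ℤ.^-*-assoc b m n ⟩
  b ^ℤ (m * n)  ≡⟨ cong (b ^ℤ_) (*-comm m n) ⟩
  b ^ℤ (n * m)  ≡⟨ ℤ.^-*-assoc b n m ⟨
  (b ^ℤ n) ^ℤ m ∎
  where open ≡-Reasoning

-- Congruences modulo n, and products taken modulo n.

module Congruence (n : ℕ) where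

  infix 4 _≋_

  -- A record rather than _≡_[mod_], from whose unfolding Agda cannot infer a and b.
  record _≋_ (a b : ℤ) : Set where
    constructor _by_
    field
      quotient : ℤ
      equality : a ≡ b ℤ.+ quotient ℤ.* + n

  ≋-refl : ∀ {a} → a ≋ a
  ≋-refl {a} = ℤ.0ℤ by sym (ℤ.+-identityʳ a)

  ≋-sym : ∀ {a b} → a ≋ b → b ≋ a
  ≋-sym {_} {b} (q by refl) = (ℤ.- q) by lemma b q (+ n)
    where
    lemma : ∀ b q n → b ≡ b ℤ.+ q ℤ.* n ℤ.+ (ℤ.- q) ℤ.* n
    lemma = ℤ-Solver.solve-∀

  ≋-trans : ∀ {a b c} → a ≋ b → b ≋ c → a ≋ c
  ≋-trans {_} {_} {c} (q by refl) (r by refl) = (r ℤ.+ q) by lemma c q r (+ n)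
    where
    lemma : ∀ c q r n → c ℤ.+ r ℤ.* n ℤ.+ q ℤ.* n ≡ c ℤ.+ (r ℤ.+ q) ℤ.* n
    lemma = ℤ-Solver.solve-∀

  ≋-setoid : Setoid _ _
  ≋-setoid = record
    { _≈_ = _≋_
    ; isEquivalence = record { refl = ≋-refl ; sym = ≋-sym ; trans = ≋-trans }
    }

  module ≋-Reasoning = SetoidReasoning ≋-setoid

  *-cong-≋ : ∀ {a b c d} → a ≋ b → c ≋ d → a ℤ.* c ≋ b ℤ.* d
  *-cong-≋ {_} {b} {_} {d} (q by refl) (r by refl) =
    (q ℤ.* d ℤ.+ b ℤ.* r ℤ.+ q ℤ.* r ℤ.* + n) by lemma b d q r (+ n)
    where
    lemma : ∀ b d q r n → (b ℤ.+ q ℤ.* n) ℤ.* (d ℤ.+ r ℤ.* n)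
                        ≡ b ℤ.* d ℤ.+ (q ℤ.* d ℤ.+ b ℤ.* r ℤ.+ q ℤ.* r ℤ.* n) ℤ.* n
    lemma = ℤ-Solver.solve-∀

  ^-cong-≋ : ∀ {a b} k → a ≋ b → a ^ℤ k ≋ b ^ℤ k
  ^-cong-≋ zero    a≋b = ≋-refl
  ^-cong-≋ (suc k) a≋b = *-cong-≋ a≋b (^-cong-≋ k a≋b)

  signed⇒≋ : ∀ {a b} → + n Signed.∣ a ℤ.- b → a ≋ b
  signed⇒≋ {a} {b} (Signed.divides q eq) = q by trans (lemma a b) (cong (λ x → b ℤ.+ x) eq)
    where
    lemma : ∀ a b → a ≡ b ℤ.+ (a ℤ.- b)
    lemma = ℤ-Solver.solve-∀

  ≋⇒signed : ∀ {a b} → a ≋ b → + n Signed.∣ a ℤ.- b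
  ≋⇒signed {_} {b} (q by refl) = Signed.divides q (lemma b q (+ n))
    where
    lemma : ∀ b q n → b ℤ.+ q ℤ.* n ℤ.- b ≡ q ℤ.* n
    lemma = ℤ-Solver.solve-∀

  sum⇒≋- : ∀ {x y} → x + y ≡ n → + x ≋ -1ℤ ℤ.* + y
  sum⇒≋- {x} {y} refl = 1ℤ by lemma (+ x) (+ y)
    where
    lemma : ∀ x y → x ≡ -1ℤ ℤ.* y ℤ.+ 1ℤ ℤ.* (x ℤ.+ y)
    lemma = ℤ-Solver.solve-∀

  shift⇒≋ : ∀ {x y} → x ≡ y + n → + x ≋ + y
  shift⇒≋ {_} {y} refl = 1ℤ by cong (λ x → + y ℤ.+ x) (sym (ℤ.*-identityˡ (+ n)))

  %ℕ≡⇒≋ : .{{_ : NonZero n}} → ∀ a b → a %ℕ n ≡ b %ℕ n → a ≋ b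
  %ℕ≡⇒≋ a b eq = ≋-trans (to-remainder a)
    (subst (λ r → + r ≋ b) (sym eq) (≋-sym (to-remainder b)))
    where
    to-remainder : ∀ c → c ≋ + (c %ℕ n)
    to-remainder c = (c /ℕ n) by a≡a%ℕn+[a/ℕn]*n c n

  ∏-cong-≋ : ∀ {f g} → (∀ i → f i ≋ g i) → ∀ k → ∏ f k ≋ ∏ g k
  ∏-cong-≋ f≋g zero    = ≋-refl
  ∏-cong-≋ f≋g (suc k) = *-cong-≋ (∏-cong-≋ f≋g k) (f≋g k)

  -- Pairing i with j where i + j = k - 1 fits the middle block of multiples of 3, whose residues,
  -- up to sign, run through 2, 5, 8, ... backwards.
  ∏-reverse-≋ : ∀ {f g} k → (∀ i j → suc (i + j) ≡ k → f i ≋ g j) → ∏ f k ≋ ∏ g k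
  ∏-reverse-≋         zero    f≋g = ≋-refl
  ∏-reverse-≋ {f} {g} (suc k) f≋g = begin
    ∏ f k ℤ.* f k         ≈⟨ *-cong-≋ (∏-reverse-≋ k λ i j eq → f≋g i (suc j) (cong suc (trans (+-suc i j) eq)))
                                      (f≋g k 0 (cong suc (+-identityʳ k))) ⟩
    ∏ (g ∘ suc) k ℤ.* g 0 ≡⟨ ℤ.*-comm _ (g 0) ⟩
    g 0 ℤ.* ∏ (g ∘ suc) k ≡⟨ ∏-suc g k ⟨
    ∏ g (suc k)           ∎
    where open ≋-Reasoning

  *-cancelʳ-≋ : Prime n → ∀ {a b c} → n ∤ ℤ.∣ c ∣ → a ℤ.* c ≋ b ℤ.* c → a ≋ b
  *-cancelʳ-≋ pr {a} {b} {c} n∤c ac≋bc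
    with euclidsLemma ℤ.∣ a ℤ.- b ∣ ℤ.∣ c ∣ pr
           (subst (n ∣_) (trans (cong ℤ.∣_∣ (factor a b c)) (ℤ.abs-* (a ℤ.- b) c))
             (Signed.∣⇒∣ᵤ (≋⇒signed ac≋bc)))
    where
    factor : ∀ a b c → a ℤ.* c ℤ.- b ℤ.* c ≡ (a ℤ.- b) ℤ.* c
    factor = ℤ-Solver.solve-∀
  ... | inj₁ n∣a-b = signed⇒≋ (Signed.∣ᵤ⇒∣ n∣a-b)
  ... | inj₂ n∣c   = contradiction n∣c n∤c

  -- Makes h! cancellable modulo p, since h < p.
  prime∤! : Prime n → ∀ k → k < n → n ∤ ℤ.∣ k ! ∣
  prime∤! pr zero    _   n∣1 = contradiction (∣1⇒≡1 n∣1) λ { refl → contradiction pr λ () }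
  prime∤! pr (suc k) k<n n∣  with euclidsLemma ℤ.∣ k ! ∣ (suc k) pr
                                    (subst (n ∣_) (ℤ.abs-* (k !) (+ suc k)) n∣)
  ... | inj₁ n∣k!   = prime∤! pr k (<-trans (n<1+n k) k<n) n∣k!
  ... | inj₂ n∣1+k  = <⇒≱ k<n (∣⇒≤ n∣1+k)

  -- Powers congruent to -1 and a lower bound for the modulus.

  -- For odd m the power b^(m 2^k) would be both 1 and (-1)^m = -1. For m = 2q, replacing b by b^2
  -- lowers k and halves m, until at k = 0 a positive even m is at least 2.
  exponent-bound : ¬ (1ℤ ≋ -1ℤ) → ∀ k b m → b ^ℤ (2 ^ k) ≋ -1ℤ → b ^ℤ m ≋ 1ℤ →
    0 < m → 2 ^ suc k ≤ m
  exponent-bound 1≉-1 k b m b^2^k b^m 0<m with m divMod 2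
  exponent-bound 1≉-1 zero b _ b^2^k b^m () | result zero 0F refl
  exponent-bound 1≉-1 zero b _ b^2^k b^m _ | result (suc q) 0F refl = m≤m+n 2 _
  exponent-bound 1≉-1 (suc k) b _ b^2^k b^m 0<m | result q 0F refl =
    subst (2 ^ suc (suc k) ≤_) (*-comm 2 q) (*-monoʳ-≤ 2
      (exponent-bound 1≉-1 k (b ^ℤ 2) q
        (subst (_≋ -1ℤ) (sym (ℤ.^-*-assoc b 2 (2 ^ k))) b^2^k)
        (subst (_≋ 1ℤ) (trans (cong (b ^ℤ_) (*-comm q 2)) (sym (ℤ.^-*-assoc b 2 q))) b^m)
        (*-cancelʳ-< 2 0 q 0<m)))
  ... | result q 1F refl = contradiction 1≋-1 1≉-1
    where
    open ≋-Reasoning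
    1≋-1 : 1ℤ ≋ -1ℤ
    1≋-1 = begin
      1ℤ                             ≡⟨ ℤ.^-zeroˡ (2 ^ k) ⟨
      1ℤ ^ℤ (2 ^ k)                  ≈⟨ ^-cong-≋ (2 ^ k) b^m ⟨
      (b ^ℤ suc (q * 2)) ^ℤ (2 ^ k)  ≡⟨ ^-swap b (suc (q * 2)) (2 ^ k) ⟩
      (b ^ℤ (2 ^ k)) ^ℤ suc (q * 2)  ≈⟨ ^-cong-≋ (suc (q * 2)) b^2^k ⟩
      -1ℤ ^ℤ suc (q * 2)             ≡⟨ cong (λ x → -1ℤ ^ℤ suc x) (*-comm q 2) ⟩
      -1ℤ ^ℤ suc (2 * q)             ≡⟨ -1^[1+2*n] q ⟩
      -1ℤ                            ∎

  -- If n < L = 2^(k+1), two of the first L powers of b share a remainder, say at i < j. Then b has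
  -- power 1 at the exponent i + (L - j), which lies strictly between 0 and L, against
  -- `exponent-bound`.
  modulus-bound : .{{_ : NonZero n}} → ¬ (1ℤ ≋ -1ℤ) → ∀ k b → b ^ℤ (2 ^ k) ≋ -1ℤ → 2 ^ suc k ≤ n
  modulus-bound 1≉-1 k b b^2^k with 2 ^ suc k ≤? n
  ... | yes L≤n = L≤n
  ... | no  L≰n
    with pigeonhole (≰⇒> L≰n) (λ i → fromℕ< (n%ℕd<d (b ^ℤ toℕ i) n))
  ...   | i , j , i<j , same = contradiction
      (exponent-bound 1≉-1 k b (toℕ i + (L ∸ toℕ j)) b^2^k b^m≋1
        (<-≤-trans (m<n⇒0<n∸m (toℕ<n j)) (m≤n+m _ (toℕ i))))
      (<⇒≱ (subst (toℕ i + (L ∸ toℕ j) <_) j+[L∸j]≡L (+-monoˡ-< (L ∸ toℕ j) i<j)))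
    where
    open ≋-Reasoning
    L : ℕ
    L = 2 ^ suc k

    j+[L∸j]≡L : toℕ j + (L ∸ toℕ j) ≡ L
    j+[L∸j]≡L = m+[n∸m]≡n (<⇒≤ (toℕ<n j))

    -- Multiplying b^i ≋ b^j by b^(L - j) avoids inverting b.
    b^m≋1 : b ^ℤ (toℕ i + (L ∸ toℕ j)) ≋ 1ℤ
    b^m≋1 = begin
      b ^ℤ (toℕ i + (L ∸ toℕ j))         ≡⟨ ℤ.^-distribˡ-+-* b (toℕ i) (L ∸ toℕ j) ⟩
      b ^ℤ toℕ i ℤ.* b ^ℤ (L ∸ toℕ j)    ≈⟨ *-cong-≋ (%ℕ≡⇒≋ (b ^ℤ toℕ i) (b ^ℤ toℕ j) (fromℕ<-injective _ _ _ _ same)) ≋-refl ⟩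
      b ^ℤ toℕ j ℤ.* b ^ℤ (L ∸ toℕ j)    ≡⟨ ℤ.^-distribˡ-+-* b (toℕ j) (L ∸ toℕ j) ⟨
      b ^ℤ (toℕ j + (L ∸ toℕ j))         ≡⟨ cong (b ^ℤ_) (trans j+[L∸j]≡L (*-comm 2 (2 ^ k))) ⟩
      b ^ℤ (2 ^ k * 2)                   ≡⟨ ℤ.^-*-assoc b (2 ^ k) 2 ⟨
      (b ^ℤ (2 ^ k)) ^ℤ 2                ≈⟨ ^-cong-≋ 2 b^2^k ⟩
      1ℤ                                 ∎

-- The residue of 3^((p-1)/2) for primes p = 6m + 5.

module _ (m : ℕ) where
  open Congruence (5 + m * 6)
  open ≋-Reasoning

  -- An instance of Gauss's lemma: m + 1 counts those of 3, 6, ..., 3h that lie between p/2 and p,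
  -- the ones with negative least residue.
  3^[p-1]/2 : Prime (5 + m * 6) → (+ 3) ^ℤ (2 + m * 3) ≋ -1ℤ ^ℤ suc m
  3^[p-1]/2 pr = *-cancelʳ-≋ pr (prime∤! pr (2 + m * 3) h<p) (begin
    (+ 3) ^ℤ h ℤ.* h !                                ≡⟨ ∏-scale (+ 3) (λ i → + suc i) h ⟨
    ∏ (λ i → + 3 ℤ.* + suc i) h                       ≈⟨ ∏-cong-≋ (λ i → ≡⇒≋ (cong +_ (*-comm 3 (suc i)))) h ⟩
    -- The block lengths m, m + 1, m + 1 cut the multiples of 3 at p/2 and at p.
    ∏ triple h                                        ≡⟨ cong (∏ triple) (split m) ⟩
    ∏ triple (m + (suc m + suc m))                    ≡⟨ ∏-+ triple m (suc m + suc m) ⟩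
    low ℤ.* ∏ (λ i → triple (m + i)) (suc m + suc m)       ≡⟨ cong (low ℤ.*_) (∏-+ (λ i → triple (m + i)) (suc m) (suc m)) ⟩
    low ℤ.* (∏ (λ i → triple (m + i)) (suc m) ℤ.* ∏ (λ i → triple (m + (suc m + i))) (suc m))
      -- Middle block: 3(m + 1 + i) = p - (2 + 3j) when i + j = m. High block: 3(2m + 2 + i) = p +
      -- (1 + 3i).
      ≈⟨ *-cong-≋ (≋-refl {low}) (*-cong-≋
           (∏-reverse-≋ (suc m) (λ i j eq → sum⇒≋- (middle-sum i j eq)))
           (∏-cong-≋ (λ i → shift⇒≋ (high-shift m i)) (suc m))) ⟩
    low ℤ.* (∏ (λ i → -1ℤ ℤ.* + (2 + i * 3)) (suc m) ℤ.* ones)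
      ≡⟨ cong (λ x → low ℤ.* (x ℤ.* ones)) (∏-scale -1ℤ (λ i → + (2 + i * 3)) (suc m)) ⟩
    low ℤ.* (-1ℤ ^ℤ suc m ℤ.* twos ℤ.* ones)          ≡⟨ pull low (-1ℤ ^ℤ suc m) twos ones ⟩
    -1ℤ ^ℤ suc m ℤ.* (low ℤ.* (twos ℤ.* ones))        ≡⟨ cong (-1ℤ ^ℤ suc m ℤ.*_) (!-by-residues-mod-3 m) ⟨
    -1ℤ ^ℤ suc m ℤ.* h !                              ∎)
    where
    h : ℕ
    h = 2 + m * 3

    triple : ℕ → ℤ
    triple i = + (suc i * 3)

    low twos ones : ℤ
    low  = ∏ triple m
    twos = ∏ (λ i → + (2 + i * 3)) (suc m)
    ones = ∏ (λ i → + (1 + i * 3)) (suc m)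

    ≡⇒≋ : ∀ {a b} → a ≡ b → a ≋ b
    ≡⇒≋ refl = ≋-refl

    h<p : h < 5 + m * 6
    h<p = +-mono-<-≤ {2} {5} (s<s (s<s z<s)) (*-monoʳ-≤ m (m≤m+n 3 3))

    split : ∀ m → 2 + m * 3 ≡ m + (suc m + suc m)
    split = ℕ-Solver.solve-∀

    middle-sum : ∀ i j → suc (i + j) ≡ suc m → suc (m + i) * 3 + (2 + j * 3) ≡ 5 + m * 6
    middle-sum i j refl = lemma i j
      where
      lemma : ∀ i j → suc (i + j + i) * 3 + (2 + j * 3) ≡ 5 + (i + j) * 6
      lemma = ℕ-Solver.solve-∀

    high-shift : ∀ m i → suc (m + (suc m + i)) * 3 ≡ 1 + i * 3 + (5 + m * 6)
    high-shift = ℕ-Solver.solve-∀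

    pull : ∀ a s b c → a ℤ.* (s ℤ.* b ℤ.* c) ≡ s ℤ.* (a ℤ.* (b ℤ.* c))
    pull = ℤ-Solver.solve-∀

-- Proth primes modulo 12.

prime[3] : Prime 3
prime[3] = toWitness {a? = prime? 3} _

3∤2^ : ∀ k → 3 ∤ 2 ^ k
3∤2^ zero    3∣1 = contradiction (∣1⇒≡1 3∣1) λ ()
3∤2^ (suc k) 3∣2^ with euclidsLemma 2 (2 ^ k) prime[3] 3∣2^
... | inj₁ 3∣2   = contradiction (∣⇒≤ 3∣2) (<⇒≱ (n<1+n 2))
... | inj₂ 3∣2^k = 3∤2^ k 3∣2^k

prime∣prime⇒≡ : ∀ {p q} → Prime p → Prime q → p ∣ q → p ≡ q
prime∣prime⇒≡ pp pq p∣q with prime⇒irreducible pq p∣q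
... | inj₁ refl = contradiction pp λ ()
... | inj₂ p≡q  = p≡q

-- As N = 4 (2^k t) + 1, the residue of 2^k t modulo 3 decides N modulo 12: 0 would force 3 to
-- divide t, 2 would give the prime N > 3 the divisor 3, and 1 gives N = 5 + 12q.
proth-prime≡5[12] : ∀ k t → let N = 2 ^ (2 + k) * t + 1 in
  N > 3 → 3 ∤ t → Prime N → ∃[ q ] 2 ^ k * t ≡ 1 + q * 3
proth-prime≡5[12] k t N>3 3∤t pr with (2 ^ k * t) divMod 3
... | result q 0F eq with euclidsLemma (2 ^ k) t prime[3] (divides q eq)
...   | inj₁ 3∣2^k = contradiction 3∣2^k (3∤2^ k)
...   | inj₂ 3∣t   = contradiction 3∣t 3∤t
proth-prime≡5[12] k t N>3 3∤t pr | result q 1F eq = q , eq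
proth-prime≡5[12] k t N>3 3∤t pr | result q 2F eq =
  contradiction (prime∣prime⇒≡ prime[3] pr (divides (3 + q * 4) N≡)) (<⇒≢ N>3)
  where
  open ≡-Reasoning
  regroup : ∀ x t → 2 * (2 * x) * t + 1 ≡ 4 * (x * t) + 1
  regroup = ℕ-Solver.solve-∀
  evaluate : ∀ q → 4 * (2 + q * 3) + 1 ≡ (3 + q * 4) * 3
  evaluate = ℕ-Solver.solve-∀
  N≡ : 2 ^ (2 + k) * t + 1 ≡ (3 + q * 4) * 3
  N≡ = begin
    2 ^ (2 + k) * t + 1   ≡⟨ regroup (2 ^ k) t ⟩
    4 * (2 ^ k * t) + 1   ≡⟨ cong (λ x → 4 * x + 1) eq ⟩
    4 * (2 + q * 3) + 1   ≡⟨ evaluate q ⟩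
    (3 + q * 4) * 3       ∎

-- The two implications.

[N∸1]/2 : ∀ k t → (2 ^ suc k * t + 1 ∸ 1) / 2 ≡ 2 ^ k * t
[N∸1]/2 k t = begin
  (2 ^ suc k * t + 1 ∸ 1) / 2 ≡⟨ cong (_/ 2) (m+n∸n≡m (2 ^ suc k * t) 1) ⟩
  (2 * 2 ^ k * t) / 2         ≡⟨ cong (_/ 2) (regroup (2 ^ k) t) ⟩
  (2 ^ k * t * 2) / 2         ≡⟨ m*n/n≡m (2 ^ k * t) 2 ⟩
  2 ^ k * t                   ∎
  where
  open ≡-Reasoning
  regroup : ∀ x t → 2 * x * t ≡ x * t * 2
  regroup = ℕ-Solver.solve-∀

-- N = 5 + 12q has the form 5 + 6m with m = 2q, so the sign (-1)^(m + 1) has odd exponent.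
prime⇒3^≡-1 : ∀ k t → let N = 2 ^ (2 + k) * t + 1 in
  N > 3 → 3 ∤ t → Prime N → (+ 3) ^ℤ (2 ^ (1 + k) * t) ≡ - (+ 1) [mod + N ]
prime⇒3^≡-1 k t N>3 3∤t pr with proth-prime≡5[12] k t N>3 3∤t pr
... | q , eq = Signed.∣⇒∣ᵤ (≋⇒signed
    (subst ((+ 3) ^ℤ (2 ^ (1 + k) * t) ≋_) (-1^[1+2*n] q)
      (subst (λ h → (+ 3) ^ℤ h ≋ -1ℤ ^ℤ suc (2 * q)) (sym h≡)
        -- The modulus is a module parameter of `_≋_`, so passing between N and 5 + 6m transports
        -- the relation itself.
        (subst (λ n → Congruence._≋_ n ((+ 3) ^ℤ (2 + 2 * q * 3)) (-1ℤ ^ℤ suc (2 * q))) (sym N≡)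
          (3^[p-1]/2 (2 * q) (subst Prime N≡ pr))))))
  where
  N : ℕ
  N = 2 ^ (2 + k) * t + 1
  open Congruence N
  regroup-N : ∀ x t → 2 * (2 * x) * t + 1 ≡ 4 * (x * t) + 1
  regroup-N = ℕ-Solver.solve-∀
  evaluate-N : ∀ q → 4 * (1 + q * 3) + 1 ≡ 5 + 2 * q * 6
  evaluate-N = ℕ-Solver.solve-∀
  N≡ : N ≡ 5 + 2 * q * 6
  N≡ = trans (regroup-N (2 ^ k) t) (trans (cong (λ x → 4 * x + 1) eq) (evaluate-N q))
  evaluate-h : ∀ q → 2 * (1 + q * 3) ≡ 2 + 2 * q * 3
  evaluate-h = ℕ-Solver.solve-∀
  h≡ : 2 ^ (1 + k) * t ≡ 2 + 2 * q * 3
  h≡ = trans (*-assoc 2 (2 ^ k) t) (trans (cong (2 *_) eq) (evaluate-h q))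

-- In a proper factorisation N = c d both factors are at least 2^(k+1), but N is smaller than the
-- square of that bound.
3^≡-1⇒prime : ∀ k t → let N = 2 ^ suc k * t + 1 in
  N > 3 → t < 2 ^ suc k → (+ 3) ^ℤ (2 ^ k * t) ≡ - (+ 1) [mod + N ] → Prime N
3^≡-1⇒prime k t N>3 t<2^ 3^≡-1 =
  ¬composite⇒prime {{n>1⇒nonTrivial (<-trans (s<s z<s) N>3)}}
    λ { (hasNonTrivialDivisor {d} d<N d∣N@(divides c N≡c*d)) →
        -- Since d < N, the cofactor is nontrivial too, and the bound applies to it.
        let 1<c : 1 < c
            1<c = *-cancelʳ-< d 1 c (subst₂ _<_ (sym (*-identityˡ d)) N≡c*d d<N)
        in <⇒≱ N<2^*2^ (subst (2 ^ suc k * 2 ^ suc k ≤_) (sym N≡c*d)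
             (*-mono-≤ (divisor-bound c {{n>1⇒nonTrivial 1<c}} (divides d (trans N≡c*d (*-comm c d))))
                       (divisor-bound d d∣N))) }
  where
  N : ℕ
  N = 2 ^ suc k * t + 1

  N<2^*2^ : N < 2 ^ suc k * 2 ^ suc k
  N<2^*2^ = begin-strict
    -- Here `1 < 2 ^ suc k` unfolds to `2 * 1 ≤ 2 * 2 ^ k`.
    2 ^ suc k * t + 1         <⟨ +-monoʳ-< (2 ^ suc k * t) (*-monoʳ-≤ 2 (m^n>0 2 k)) ⟩
    2 ^ suc k * t + 2 ^ suc k ≡⟨ +-comm (2 ^ suc k * t) _ ⟩
    2 ^ suc k + 2 ^ suc k * t ≡⟨ *-suc (2 ^ suc k) t ⟨
    2 ^ suc k * suc t         ≤⟨ *-monoʳ-≤ (2 ^ suc k) t<2^ ⟩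
    2 ^ suc k * 2 ^ suc k     ∎
    where open ≤-Reasoning

  -- The congruence passes from N to d, where b = 3^t satisfies b^(2^k) = 3^((N-1)/2) = -1.
  divisor-bound : ∀ d → .{{NonTrivial d}} → d ∣ N → 2 ^ suc k ≤ d
  divisor-bound d d∣N = modulus-bound {{nonTrivial⇒nonZero d}} 1≉-1 k ((+ 3) ^ℤ t) (signed⇒≋
      (subst (λ x → + d Signed.∣ x ℤ.- -1ℤ)
        (trans (cong ((+ 3) ^ℤ_) (*-comm (2 ^ k) t)) (sym (ℤ.^-*-assoc (+ 3) t (2 ^ k))))
        (Signed.∣ᵤ⇒∣ (∣-trans d∣N 3^≡-1))))
    where
    open Congruence d
    -- Otherwise d divides 2; being nontrivial it equals 2, which cannot divide the odd number N.
    1≉-1 : ¬ (1ℤ ≋ -1ℤ)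
    1≉-1 1≋-1 with prime⇒irreducible prime[2] (Signed.∣⇒∣ᵤ (≋⇒signed 1≋-1))
    ... | inj₁ d≡1  = nonTrivial⇒≢1 d≡1
    ... | inj₂ refl = contradiction
      (∣1⇒≡1 (∣m+n∣m⇒∣n d∣N (∣-trans (m∣m*n (2 ^ k)) (m∣m*n t)))) λ ()

theorem1p3 : (e t : ℕ) → let N = 2 ^ e * t + 1 in
    N > 3 → 2 ∤ t → 2 ^ e > t → t > 0 → 3 ∤ t →
    Prime N ⇔ ((+ 3) ^ℤ ((N ∸ 1) / 2) ≡ - (+ 1) [mod + N ])
-- The bounds 0 < t < 2^e leave no t for e = 0 and only t = 1, hence N = 3, for e = 1. From e = 2
-- on, 4 divides N - 1, as the residue of N modulo 12 requires.
theorem1p3 zero          (suc t) N>3 _ (s<s ()) _ _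
theorem1p3 (suc zero)    1       N>3 _ _ _ _ = contradiction N>3 (<-irrefl refl)
theorem1p3 (suc zero)    (suc (suc t)) N>3 _ (s<s (s<s ())) _ _
theorem1p3 (suc (suc k)) t       N>3 _ t<2^e _ 3∤t
  rewrite [N∸1]/2 (suc k) t =
  mk⇔ (prime⇒3^≡-1 k t N>3 3∤t) (3^≡-1⇒prime (suc k) t N>3 t<2^e)
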